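{- Let $W$ and $R$ be positive integers and $\epsilon>0$. Set $\upsilon=\lceil\log(\epsilon^{ -1}W)\rceil$ and $k=\left\lceil\frac{1}{2\epsilon-2^{ -\upsilon}}\right\rceil$. Then Algorithm 3 (described in the context, run with these parameters) provides an $RW\epsilon$-additive approximation for Basic-Summing; that is, for every input stream of integers in $\{0,1,\dots,R\}$ and at every time, the value $\widehat S$ returned by Query satisfies $|\widehat S-S|\le RW\epsilon$.
   Context: All logarithms are base 2. Basic-Summing: given a stream of integers in $\{0,1,\dots,R\}$ arriving one at a time, maintain the sum $S$ of the last $W$ elements (elements before the beginning of the stream are regarded as 0). For $z\in[0,1]$, $\mathrm{Round}_{\upsilon}(z)$ denotes rounding of $z$ to the nearest value $\widetilde z$ such that $2^{\upsilon}\widetilde z$ is an integer. Algorithm 3 (intended for small $\epsilon$). Variables: a fractional number $y$, integers $B,i$, and an array $b=(b_0,\dots,b_{W-1})$ of nonnegative integers, all initialized to $0$. Add(element $x$): do in order: (1) $x'=\mathrm{Round}_{\upsilon}\left(\frac xR\right)$; (2) $B\leftarrow B-b_i$; (3) $b_i\leftarrow\left\lfloor\frac{y+x'}{W/k}\right\rfloor$; (4) $y\leftarrow y+x'-b_i\cdot\frac Wk$; (5) $B\leftarrow B+b_i$; (6) $i\leftarrow i+1\bmod W$. Query: return $R\cdot\left(\frac Wk\cdot B+y-\frac W{2k}\right)$. Each arriving stream element is processed by one call of Add. -}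

module Defs where

open import Data.Empty using (⊥; ⊥-elim)
open import Data.Fin.Base using (Fin; toℕ)
open import Data.Integer.Base as ℤ using (ℤ; +_; -[1+_])
import Data.Integer.Properties as ℤ
open import Data.List.Base using (applyUpTo)
open import Data.Nat.Base as ℕ using (ℕ; zero; suc; NonZero)
open import Data.Nat.ListAction using (sum)
open import Data.Nat.Coprimality using (1-coprimeTo)
open import Data.Nat.DivMod using (_mod_)
import Data.Nat.Properties as ℕ
open import Data.Product.Base using (∃; _×_; _,_)
open import Data.Rational.Base
  using (ℚ; 0ℚ; 1ℚ; ½; _/_; _+_; _-_; _*_; -_; 1/_; _÷_; ∣_∣; _≤_; _<_; floor;
         Positive; positive; toℚᵘ; *≤*)
import Data.Rational.Base as ℚ
import Data.Rational.Properties as ℚ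
import Data.Rational.Unnormalised.Base as ℚᵘ
import Data.Rational.Unnormalised.Properties as ℚᵘ
open import Data.Sum.Base using (_⊎_; inj₁; inj₂)
open import Data.Vec.Base using (Vec; lookup; replicate; _[_]≔_)
open import Relation.Binary.Definitions using (tri<; tri≈; tri>)
open import Relation.Binary.PropositionalEquality
  using (_≡_; refl; sym; trans; cong; subst; subst₂)
open import Relation.Nullary.Negation using (¬_)

------------------------------------------------------------------------
-- Rational arithmetic

pow2 : ℤ → ℚ
pow2 (+ n)    = + (2 ℕ.^ n) / 1
pow2 -[1+ n ] = (+ 1 / (2 ℕ.^ suc n)) {{ℕ.m^n≢0 2 (suc n)}}

/-positive : ∀ m n .{{_ : NonZero m}} .{{_ : NonZero n}} → Positive (+ m / n)
/-positive m n = ℚ.normalize-pos m n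

n*1/n≡1 : ∀ n .{{_ : NonZero n}} → (+ n / 1) * (+ 1 / n) ≡ 1ℚ
n*1/n≡1 n@(suc n-1) = ℚ.toℚᵘ-injective (begin
  toℚᵘ ((+ n / 1) * (+ 1 / n))          ≈⟨ ℚ.toℚᵘ-homo-* (+ n / 1) (+ 1 / n) ⟩
  toℚᵘ (+ n / 1) ℚᵘ.* toℚᵘ (+ 1 / n)    ≈⟨ ℚᵘ.*-cong (ℚ.toℚᵘ-fromℚᵘ (ℚᵘ.mkℚᵘ (+ n) 0))
                                                    (ℚ.toℚᵘ-fromℚᵘ (ℚᵘ.mkℚᵘ (+ 1) n-1)) ⟩
  ℚᵘ.mkℚᵘ (+ n) 0 ℚᵘ.* ℚᵘ.mkℚᵘ (+ 1) n-1 ≈⟨ ℚᵘ.*≡* (lemma n) ⟩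
  ℚᵘ.1ℚᵘ ∎)
  where
  open ℚᵘ.≃-Reasoning
  lemma : ∀ m → + m ℤ.* + 1 ℤ.* + 1 ≡ + 1 ℤ.* + (1 ℕ.* m)
  lemma m = trans (ℤ.*-identityʳ _) (trans (ℤ.*-comm (+ m) (+ 1))
              (cong (λ j → + 1 ℤ.* + j) (sym (ℕ.*-identityˡ m))))

1/n≤1 : ∀ n .{{_ : NonZero n}} → + 1 / n ≤ 1ℚ
1/n≤1 n@(suc n-1) = subst (_≤ 1ℚ) (sym (ℚ.normalize-coprime (1-coprimeTo n)))
  (*≤* (ℤ.*-monoˡ-≤-nonNeg (+ 1) (ℤ.+≤+ (ℕ.s≤s ℕ.z≤n))))

pow2-positive : ∀ i → Positive (pow2 i)
pow2-positive (+ n)    = /-positive (2 ℕ.^ n) 1 {{ℕ.m^n≢0 2 n}}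
pow2-positive -[1+ n ] = /-positive 1 (2 ℕ.^ suc n) {{_}} {{ℕ.m^n≢0 2 (suc n)}}

pow2-inverse : ∀ i → pow2 i * pow2 (ℤ.- i) ≡ 1ℚ
pow2-inverse (+ zero)  = refl
pow2-inverse (+ suc n) = n*1/n≡1 (2 ℕ.^ suc n) {{ℕ.m^n≢0 2 (suc n)}}
pow2-inverse -[1+ n ]  = trans (ℚ.*-comm (pow2 -[1+ n ]) (pow2 (+ suc n)))
                               (n*1/n≡1 (2 ℕ.^ suc n) {{ℕ.m^n≢0 2 (suc n)}})

x-1<x : ∀ x → x - 1ℚ < x
x-1<x x = subst (x - 1ℚ <_) (ℚ.+-identityʳ x) (ℚ.+-monoʳ-< x (ℚ.negative⁻¹ (- 1ℚ)))

x<x+1 : ∀ x → x < x + 1ℚ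
x<x+1 x = subst (_< x + 1ℚ) (ℚ.+-identityʳ x) (ℚ.+-monoʳ-< x (ℚ.positive⁻¹ 1ℚ))

x-y+y≡x : ∀ x y → x - y + y ≡ x
x-y+y≡x x y = trans (ℚ.+-assoc x (- y) y)
              (trans (cong (λ z → x + z) (ℚ.+-inverseˡ y)) (ℚ.+-identityʳ x))

x+y-y≡x : ∀ x y → x + y - y ≡ x
x+y-y≡x x y = trans (ℚ.+-assoc x y (- y))
              (trans (cong (λ z → x + z) (ℚ.+-inverseʳ y)) (ℚ.+-identityʳ x))

module _ (c : ℚ) .{{pos : Positive c}} where

  divide : ℚ → ℚ
  divide x = (x ÷ c) {{ℚ.pos⇒nonZero c}}

  divide-* : ∀ x → divide x * c ≡ x
  divide-* x = trans (ℚ.*-assoc x ((1/ c) {{ℚ.pos⇒nonZero c}}) c)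
    (trans (cong (x *_) (ℚ.*-inverseˡ c {{ℚ.pos⇒nonZero c}})) (ℚ.*-identityʳ x))

  *c<⇒<divide : ∀ {x y} → x * c < y → x < divide y
  *c<⇒<divide {x} {y} h = ℚ.*-cancelʳ-<-nonNeg c {{ℚ.pos⇒nonNeg c}}
    (subst (x * c <_) (sym (divide-* y)) h)

  <*c⇒divide< : ∀ {x y} → x < y * c → divide x < y
  <*c⇒divide< {x} {y} h = ℚ.*-cancelʳ-<-nonNeg c {{ℚ.pos⇒nonNeg c}}
    (subst (_< y * c) (sym (divide-* x)) h)

------------------------------------------------------------------------
-- Dedekind reals

record ℝ : Set₁ where
  field
    L U         : ℚ → Set
    L-inhabited : ∃ L
    U-inhabited : ∃ U
    L-lower     : ∀ {p q} → p < q → L q → L p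
    U-upper     : ∀ {p q} → p < q → U p → U q
    L-open      : ∀ {p} → L p → ∃ λ q → p < q × L q
    U-open      : ∀ {q} → U q → ∃ λ p → p < q × U p
    disjoint    : ∀ {q} → L q → ¬ U q
    located     : ∀ {p q} → p < q → L p ⊎ U q

  L<U : ∀ {p q} → L p → U q → p < q
  L<U {p} {q} lp uq with ℚ.<-cmp p q
  ... | tri< p<q _ _  = p<q
  ... | tri≈ _ refl _ = ⊥-elim (disjoint lp uq)
  ... | tri> _ _ q<p  = ⊥-elim (disjoint (L-lower q<p lp) uq)

open ℝ

infix 4 _<ℝ_ _≤ℝ_

_<ℝ_ : ℝ → ℝ → Set
x <ℝ y = ∃ λ q → U x q × L y q

_≤ℝ_ : ℝ → ℝ → Set
x ≤ℝ y = ∀ q → L x q → L y q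

fromℚ : ℚ → ℝ
fromℚ x = record
  { L           = _< x
  ; U           = x <_
  ; L-inhabited = x - 1ℚ , x-1<x x
  ; U-inhabited = x + 1ℚ , x<x+1 x
  ; L-lower     = ℚ.<-trans
  ; U-upper     = λ p<q x<p → ℚ.<-trans x<p p<q
  ; L-open      = λ p<x → let r , p<r , r<x = ℚ.<-dense p<x in r , p<r , r<x
  ; U-open      = λ x<q → let r , x<r , r<q = ℚ.<-dense x<q in r , r<q , x<r
  ; disjoint    = ℚ.<-asym
  ; located     = loc
  }
  where
  loc : ∀ {p q} → p < q → p < x ⊎ x < q
  loc {p} p<q with ℚ.<-cmp p x
  ... | tri< p<x _ _  = inj₁ p<x
  ... | tri≈ _ refl _ = inj₂ p<q
  ... | tri> _ _ x<p  = inj₂ (ℚ.<-trans x<p p<q)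

infixl 6 _-ℚ_
infixr 7 _·_

_-ℚ_ : ℝ → ℚ → ℝ
x -ℚ c = record
  { L           = λ q → L x (q + c)
  ; U           = λ q → U x (q + c)
  ; L-inhabited = let p , lp = L-inhabited x in
                  p - c , subst (L x) (sym (x-y+y≡x p c)) lp
  ; U-inhabited = let p , up = U-inhabited x in
                  p - c , subst (U x) (sym (x-y+y≡x p c)) up
  ; L-lower     = λ p<q → L-lower x (ℚ.+-monoˡ-< c p<q)
  ; U-upper     = λ p<q → U-upper x (ℚ.+-monoˡ-< c p<q)
  ; L-open      = λ {p} lp → let r , p<r , lr = L-open x lp in
                  r - c , subst (_< r - c) (x+y-y≡x p c) (ℚ.+-monoˡ-< (- c) p<r) ,
                  subst (L x) (sym (x-y+y≡x r c)) lr
  ; U-open      = λ {q} uq → let r , r<q , ur = U-open x uq in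
                  r - c , subst (r - c <_) (x+y-y≡x q c) (ℚ.+-monoˡ-< (- c) r<q) ,
                  subst (U x) (sym (x-y+y≡x r c)) ur
  ; disjoint    = disjoint x
  ; located     = λ p<q → located x (ℚ.+-monoˡ-< c p<q)
  }

-- The product of a real with a positive natural number.
_·_ : (n : ℕ) → ℝ → .{{_ : NonZero n}} → ℝ
n · x = record
  { L           = λ q → L x (q * c)
  ; U           = λ q → U x (q * c)
  ; L-inhabited = let p , lp = L-inhabited x in
                  divide c p , subst (L x) (sym (divide-* c p)) lp
  ; U-inhabited = let p , up = U-inhabited x in
                  divide c p , subst (U x) (sym (divide-* c p)) up
  ; L-lower     = λ p<q → L-lower x (ℚ.*-monoˡ-<-pos c p<q)
  ; U-upper     = λ p<q → U-upper x (ℚ.*-monoˡ-<-pos c p<q)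
  ; L-open      = λ lp → let r , p<r , lr = L-open x lp in
                  divide c r , *c<⇒<divide c p<r ,
                  subst (L x) (sym (divide-* c r)) lr
  ; U-open      = λ uq → let r , r<q , ur = U-open x uq in
                  divide c r , <*c⇒divide< c r<q ,
                  subst (U x) (sym (divide-* c r)) ur
  ; disjoint    = disjoint x
  ; located     = λ p<q → located x (ℚ.*-monoˡ-<-pos c p<q)
  }
  where
  c : ℚ
  c = + 1 / n
  instance
    c-pos : Positive c
    c-pos = /-positive 1 n

module _ (x : ℝ) (x>0 : fromℚ 0ℚ <ℝ x) where

  L-zero : L x 0ℚ
  L-zero = let p , 0<p , lp = x>0 in L-lower x 0<p lp

  U-positive : ∀ {r} → U x r → Positive r
  U-positive ur = positive (L<U x L-zero ur)

  inv : ℝ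
  inv = record
    { L           = L⁻¹
    ; U           = U⁻¹
    ; L-inhabited = let r , ur = U-inhabited x in
                    0ℚ , r , ur , subst (_< 1ℚ) (sym (ℚ.*-zeroˡ r)) (ℚ.positive⁻¹ 1ℚ)
    ; U-inhabited = U-inh
    ; L-lower     = λ p<q (r , ur , qr<1) → r , ur ,
                    ℚ.<-trans (ℚ.*-monoˡ-<-pos r {{U-positive ur}} p<q) qr<1
    ; U-upper     = λ p<q (r , 0<r , lr , 1<pr) → r , 0<r , lr ,
                    ℚ.<-trans 1<pr (ℚ.*-monoˡ-<-pos r {{positive 0<r}} p<q)
    ; L-open      = L-op
    ; U-open      = U-op
    ; disjoint    = λ {q} → disj {q}
    ; located     = loc
    }
    where
    L⁻¹ U⁻¹ : ℚ → Set
    L⁻¹ q = ∃ λ r → U x r × q * r < 1ℚ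
    U⁻¹ q = ∃ λ r → 0ℚ < r × L x r × 1ℚ < q * r

    U-inh : ∃ U⁻¹
    U-inh = let r , 0<r , lr = x>0 in
      divide r {{positive 0<r}} (1ℚ + 1ℚ) , r , 0<r , lr ,
      subst (1ℚ <_) (sym (divide-* r {{positive 0<r}} (1ℚ + 1ℚ))) (x<x+1 1ℚ)

    L-op : ∀ {p} → L⁻¹ p → ∃ λ q → p < q × L⁻¹ q
    L-op {p} (r , ur , pr<1) with ℚ.<-dense pr<1
    ... | m , pr<m , m<1 = divide r m , *c<⇒<divide r pr<m , r , ur ,
          subst (_< 1ℚ) (sym (divide-* r m)) m<1
      where instance
        r-pos : Positive r
        r-pos = U-positive ur

    U-op : ∀ {q} → U⁻¹ q → ∃ λ p → p < q × U⁻¹ p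
    U-op {q} (r , 0<r , lr , 1<qr) with ℚ.<-dense 1<qr
    ... | m , 1<m , m<qr = divide r m , <*c⇒divide< r m<qr , r , 0<r , lr ,
          subst (1ℚ <_) (sym (divide-* r m)) 1<m
      where instance
        r-pos : Positive r
        r-pos = positive 0<r

    disj : ∀ {q} → L⁻¹ q → ¬ U⁻¹ q
    disj {q} (r , ur , qr<1) (s , 0<s , ls , 1<qs) =
      ℚ.<-asym (ℚ.<-trans 1<qs (ℚ.*-monoʳ-<-pos q {{q-pos}} (L<U x ls ur))) qr<1
      where
      0<q : 0ℚ < q
      0<q = ℚ.*-cancelʳ-<-nonNeg s {{ℚ.pos⇒nonNeg s {{positive 0<s}}}}
        (subst (_< q * s) (sym (ℚ.*-zeroˡ s)) (ℚ.<-trans (ℚ.positive⁻¹ 1ℚ) 1<qs))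
      q-pos : Positive q
      q-pos = positive 0<q

    loc⁺ : ∀ {p q} → p < q → .{{_ : Positive p}} .{{_ : Positive q}} → L⁻¹ p ⊎ U⁻¹ q
    loc⁺ {p} {q} p<q = go (ℚ.<-dense 1/q<1/p)
      where
      1/q<1/p : divide q 1ℚ < divide p 1ℚ
      1/q<1/p = <*c⇒divide< q (subst (_< divide p 1ℚ * q) (divide-* p 1ℚ)
        (ℚ.*-monoʳ-<-pos (divide p 1ℚ)
          {{ℚ.pos*pos⇒pos 1ℚ ((1/ p) {{ℚ.pos⇒nonZero p}}) {{ℚ.1/pos⇒pos p}}}} p<q))
      go : (∃ λ s → divide q 1ℚ < s × s < divide p 1ℚ) → L⁻¹ p ⊎ U⁻¹ q
      go (s , 1/q<s , s<1/p) with ℚ.<-dense s<1/p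
      ... | t , s<t , t<1/p with located x s<t
      ...   | inj₁ ls = inj₂ (s , 0<s , ls ,
                subst₂ _<_ (divide-* q 1ℚ) (ℚ.*-comm s q) (ℚ.*-monoˡ-<-pos q 1/q<s))
        where
        0<s : 0ℚ < s
        0<s = ℚ.<-trans (*c<⇒<divide q (subst (_< 1ℚ) (sym (ℚ.*-zeroˡ q)) (ℚ.positive⁻¹ 1ℚ))) 1/q<s
      ...   | inj₂ ut = inj₁ (t , ut ,
                subst₂ _<_ (ℚ.*-comm t p) (divide-* p 1ℚ) (ℚ.*-monoˡ-<-pos p t<1/p))

    loc : ∀ {p q} → p < q → L⁻¹ p ⊎ U⁻¹ q
    loc {p} {q} p<q with ℚ.<-cmp 0ℚ p
    ... | tri< 0<p _ _  = loc⁺ p<q {{positive 0<p}} {{positive (ℚ.<-trans 0<p p<q)}}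
    ... | tri≈ _ refl _ = let r , ur = U-inhabited x in
          inj₁ (r , ur , subst (_< 1ℚ) (sym (ℚ.*-zeroˡ r)) (ℚ.positive⁻¹ 1ℚ))
    ... | tri> _ _ p<0  = let r , ur = U-inhabited x in
          inj₁ (r , ur , ℚ.<-trans
            (subst (p * r <_) (ℚ.*-zeroˡ r) (ℚ.*-monoˡ-<-pos r {{U-positive ur}} p<0))
            (ℚ.positive⁻¹ 1ℚ))

  inv-positive : fromℚ 0ℚ <ℝ inv
  inv-positive = let r , ur = U-inhabited x in
    L-open inv (r , ur , subst (_< 1ℚ) (sym (ℚ.*-zeroˡ r)) (ℚ.positive⁻¹ 1ℚ))

------------------------------------------------------------------------
-- Ceilings

-- n = ⌈ x ⌉.  A relation, because the ceiling of a real is not computable.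
IsCeiling : ℝ → ℤ → Set
IsCeiling x n = fromℚ ((n ℤ.- + 1) / 1) <ℝ x × x ≤ℝ fromℚ (n / 1)

-- n = ⌈ log₂ x ⌉ for x > 0, that is, n - 1 < log₂ x ≤ n.
IsCeilingLog₂ : ℝ → ℤ → Set
IsCeilingLog₂ x n = fromℚ (pow2 (n ℤ.- + 1)) <ℝ x × x ≤ℝ fromℚ (pow2 n)

ceiling-nonZero : ∀ x k → fromℚ 0ℚ <ℝ x → IsCeiling x (+ k) → NonZero k
ceiling-nonZero x zero    (q , 0<q , lq) (_ , x≤0) = ⊥-elim (ℚ.<-asym 0<q (x≤0 q lq))
ceiling-nonZero x (suc k) _ _ = _

-- With υ = ⌈ log₂ (ε⁻¹ W) ⌉, the number 2ε - 2^(-υ) is positive, so it has a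
-- reciprocal.
gap : ℝ → ℤ → ℝ
gap ε υ = 2 · ε -ℚ pow2 (ℤ.- υ)

gap-positive : ∀ W .{{_ : NonZero W}} ε (ε>0 : fromℚ 0ℚ <ℝ ε) υ →
               IsCeilingLog₂ (W · inv ε ε>0) υ → fromℚ 0ℚ <ℝ gap ε υ
gap-positive W ε ε>0 υ (_ , upper) = go (ℚ.<-dense δ/2<δ)
  where
  δ c : ℚ
  δ = pow2 (ℤ.- υ)
  c = + 1 / W
  instance
    δ-pos : Positive δ
    δ-pos = pow2-positive (ℤ.- υ)
    c-pos : Positive c
    c-pos = /-positive 1 W
    2^υ-pos : Positive (pow2 υ)
    2^υ-pos = pow2-positive υ
  δ/2<δ : δ * ½ < δ
  δ/2<δ = subst (δ * ½ <_) (ℚ.*-identityʳ δ)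
    (ℚ.*-monoʳ-<-pos δ {½} {1ℚ} (ℚ.*<* (ℤ.+<+ (ℕ.s≤s (ℕ.s≤s ℕ.z≤n)))))

  small : ∀ {q} → U ε q → q < δ → ⊥
  small {q} uq q<δ = ℚ.<-irrefl refl (ℚ.<-≤-trans 2^υ<2^υ*c 2^υ*c≤2^υ)
    where
    L-inv : L (inv ε ε>0) (pow2 υ)
    L-inv = q , uq , subst (pow2 υ * q <_) (pow2-inverse υ) (ℚ.*-monoʳ-<-pos (pow2 υ) q<δ)
    2^υ<2^υ*c : pow2 υ < pow2 υ * c
    2^υ<2^υ*c = subst (_< pow2 υ * c) (divide-* c (pow2 υ)) (ℚ.*-monoˡ-<-pos c
      (upper (divide c (pow2 υ)) (subst (L (inv ε ε>0)) (sym (divide-* c (pow2 υ))) L-inv)))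
    2^υ*c≤2^υ : pow2 υ * c ≤ pow2 υ
    2^υ*c≤2^υ = subst (pow2 υ * c ≤_) (ℚ.*-identityʳ (pow2 υ))
      (ℚ.*-monoˡ-≤-nonNeg (pow2 υ) {{ℚ.pos⇒nonNeg (pow2 υ)}} (1/n≤1 W))

  go : (∃ λ p → δ * ½ < p × p < δ) → fromℚ 0ℚ <ℝ gap ε υ
  go (p , δ/2<p , p<δ) with ℚ.<-dense p<δ
  ... | q , p<q , q<δ with located ε p<q
  ...   | inj₂ uq = ⊥-elim (small uq q<δ)
  ...   | inj₁ lp = L-open (gap ε υ) {0ℚ}
            (L-lower ε (subst (λ z → z * ½ < p) (sym (ℚ.+-identityˡ δ)) δ/2<p) lp)

------------------------------------------------------------------------
-- Rounding

OnGrid : ℤ → ℚ → Set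
OnGrid υ z = ∃ λ (n : ℤ) → pow2 υ * z ≡ n / 1

-- Ties may be broken arbitrarily.
IsRounding : ℤ → (ℚ → ℚ) → Set
IsRounding υ rnd = ∀ z → 0ℚ ≤ z → z ≤ 1ℚ →
  OnGrid υ (rnd z) × (∀ w → OnGrid υ w → ∣ rnd z - z ∣ ≤ ∣ w - z ∣)

------------------------------------------------------------------------
-- Basic-Summing

Stream : ℕ → Set
Stream R = ℕ → Fin (suc R)

-- The (j+1)-st most recent element after t arrivals, 0 before the beginning.
recent : ∀ {R} → Stream R → ℕ → ℕ → ℕ
recent x zero    _       = 0
recent x (suc t) zero    = toℕ (x t)
recent x (suc t) (suc j) = recent x t j

windowSum : ∀ {R} → ℕ → Stream R → ℕ → ℕ
windowSum W x t = sum (applyUpTo (recent x t) W)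

------------------------------------------------------------------------
-- The algorithm

-- The entries of b are integers here: that they are never negative is a property
-- of the runs.
record State (W : ℕ) : Set where
  constructor mkState
  field
    y : ℚ
    B : ℤ
    i : Fin W
    b : Vec ℤ W

module Algorithm (W R k : ℕ) .{{_ : NonZero W}} .{{_ : NonZero R}} .{{_ : NonZero k}}
                 (rnd : ℚ → ℚ) where

  block : ℚ
  block = + W / k

  instance
    block-nonZero : ℚ.NonZero block
    block-nonZero = ℚ.pos⇒nonZero block {{/-positive W k}}

  init : State W
  init = mkState 0ℚ (+ 0) (0 mod W) (replicate W (+ 0))

  add : Fin (suc R) → State W → State W
  add x (mkState y B i b) =
    let x′ = rnd (+ toℕ x / R)
        B₁ = B ℤ.- lookup b i
        bᵢ = floor ((y + x′) ÷ block)
        y′ = y + x′ - bᵢ / 1 * block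
        B₂ = B₁ ℤ.+ bᵢ
    in mkState y′ B₂ (suc (toℕ i) mod W) (b [ i ]≔ bᵢ)

  query : State W → ℚ
  query (mkState y B i b) =
    + R / 1 * (block * (B / 1) + y - (+ W / (2 ℕ.* k)) {{ℕ.m*n≢0 2 k}})

  run : Stream R → ℕ → State W
  run x zero    = init
  run x (suc t) = add (x t) (run x t)

  estimate : Stream R → ℕ → ℚ
  estimate x t = query (run x t)

module Submission where

-- Let block = W / k, let P, Ξ and X be the prefix sums of the values b_i written by
-- the algorithm, of the rounded elements and of the elements, and let s = t ∸ W.
--
-- The cyclic array always holds the last W values written, so B = P t - P s
-- (B≡window).  Each step moves a multiple of block from the pool y + x′ to the array
-- and keeps the remainder, so y t = Ξ t - block * P t (y≡), where y stays in
-- [0, block] (0≤y, y≤block).  Hence block * B + y = (Ξ t - Ξ s) + y s: the estimate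
-- without its correction is the sum of the rounded elements of the window plus the
-- remainder of W steps ago.  As the correction W / 2k is block / 2, the error of the
-- estimate is (estimate-error)
--
--   R * ((y s - block / 2) + ((Ξ t - X t / R) - (Ξ s - X s / R))).
--
-- The first summand is at most block / 2 in absolute value.  The second is a sum of
-- at most W rounding errors, each at most 2^(-υ) / 2 (rounding-error).  Together they
-- give the bound R W (1 / k + 2^(-υ)) / 2 (∣estimate-error∣≤).  Finally k ≥ 1 / gap
-- with gap = 2 ε - 2^(-υ) gives 1 / k ≤ 2 ε - 2^(-υ) (1/k≤gap), which turns the bound
-- into R W ε.  Only this last part involves a real number, and locatedness of its
-- Dedekind cuts replaces the case distinctions on the order.

open import Defs
open import Data.Nat.Base using (ℕ; NonZero)
open import Data.Integer.Base using (ℤ; +_)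
open import Data.Rational.Base using (ℚ; 0ℚ; _/_; _-_; ∣_∣)

open import Data.Empty using (⊥-elim)
open import Data.Fin.Base using (toℕ)
import Data.Fin.Properties as Fin
import Data.Integer.Base as ℤ
import Data.Integer.DivMod as ℤ
import Data.Integer.Properties as ℤ
open import Data.Nat.Base as ℕ using (zero; suc; _∸_; _%_)
import Data.Nat.DivMod as ℕ
open import Data.Nat.DivMod using (_mod_)
import Data.Nat.Properties as ℕ
open import Data.Product.Base using (_,_; proj₂)
open import Data.Rational.Base as ℚ
  using (1ℚ; ½; _+_; _*_; -_; _≤_; _<_; floor; mkℚ; Positive; toℚᵘ)
import Data.Rational.Properties as ℚ
open import Data.Rational.Solver using (module +-*-Solver)
import Data.Rational.Unnormalised.Base as ℚᵘ
import Data.Rational.Unnormalised.Properties as ℚᵘ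
open import Data.Sum.Base using (inj₁; inj₂)
open import Data.Vec.Base using (lookup)
import Data.Vec.Properties as Vec
open import Relation.Binary.Definitions using (tri<; tri≈; tri>)
open import Relation.Binary.PropositionalEquality
  using (_≡_; _≢_; refl; sym; trans; cong; cong₂; subst; subst₂; module ≡-Reasoning)
open import Relation.Nullary.Decidable using (yes; no)

open ℝ
open +-*-Solver

------------------------------------------------------------------------
-- Integers and fractions as rationals

private
  toℚᵘ-/ : ∀ i n .{{_ : NonZero n}} → toℚᵘ (i / n) ℚᵘ.≃ (i ℚᵘ./ n)
  toℚᵘ-/ i (suc n-1) = ℚ.toℚᵘ-fromℚᵘ (ℚᵘ.mkℚᵘ i n-1)

/1-homo-+ : ∀ i j → (i ℤ.+ j) / 1 ≡ i / 1 + j / 1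
/1-homo-+ i j = ℚ.toℚᵘ-injective (begin
  toℚᵘ ((i ℤ.+ j) / 1)            ≈⟨ toℚᵘ-/ (i ℤ.+ j) 1 ⟩
  (i ℤ.+ j) ℚᵘ./ 1                ≈⟨ ℚᵘ.*≡* (cong (ℤ._* + 1)
                                      (sym (cong₂ ℤ._+_ (ℤ.*-identityʳ i) (ℤ.*-identityʳ j)))) ⟩
  (i ℚᵘ./ 1) ℚᵘ.+ (j ℚᵘ./ 1)      ≈⟨ ℚᵘ.+-cong (toℚᵘ-/ i 1) (toℚᵘ-/ j 1) ⟨
  toℚᵘ (i / 1) ℚᵘ.+ toℚᵘ (j / 1)  ≈⟨ ℚ.toℚᵘ-homo-+ (i / 1) (j / 1) ⟨
  toℚᵘ (i / 1 + j / 1)            ∎)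
  where open ℚᵘ.≃-Reasoning

/1-homo-- : ∀ i j → (i ℤ.- j) / 1 ≡ i / 1 - j / 1
/1-homo-- i j = trans (sym (x+y-y≡x ((i ℤ.- j) / 1) (j / 1))) (cong (_- j / 1)
  (trans (sym (/1-homo-+ (i ℤ.- j) j)) (cong (_/ 1)
    (trans (ℤ.+-assoc i (ℤ.- j) j)
      (trans (cong (λ k → i ℤ.+ k) (ℤ.+-inverseˡ j)) (ℤ.+-identityʳ i))))))

/-as-product : ∀ i n .{{_ : NonZero n}} → i / n ≡ i / 1 * (+ 1 / n)
/-as-product i n@(suc _) = ℚ.toℚᵘ-injective (begin
  toℚᵘ (i / n)                      ≈⟨ toℚᵘ-/ i n ⟩
  i ℚᵘ./ n                          ≈⟨ ℚᵘ.*≡* (cong₂ ℤ._*_ (sym (ℤ.*-identityʳ i))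
                                        (cong +_ (ℕ.*-identityˡ n))) ⟩
  (i ℚᵘ./ 1) ℚᵘ.* (+ 1 ℚᵘ./ n)      ≈⟨ ℚᵘ.*-cong (toℚᵘ-/ i 1) (toℚᵘ-/ (+ 1) n) ⟨
  toℚᵘ (i / 1) ℚᵘ.* toℚᵘ (+ 1 / n)  ≈⟨ ℚ.toℚᵘ-homo-* (i / 1) (+ 1 / n) ⟨
  toℚᵘ (i / 1 * (+ 1 / n))          ∎)
  where open ℚᵘ.≃-Reasoning

/-half : ∀ i n .{{_ : NonZero n}} → (i / (2 ℕ.* n)) {{ℕ.m*n≢0 2 n}} ≡ ½ * (i / n)
/-half i n@(suc _) = ℚ.toℚᵘ-injective (begin
  toℚᵘ (i / (2 ℕ.* n))        ≈⟨ toℚᵘ-/ i (2 ℕ.* n) ⟩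
  i ℚᵘ./ (2 ℕ.* n)            ≈⟨ ℚᵘ.*≡* (cong (ℤ._* + (2 ℕ.* n)) (sym (ℤ.*-identityˡ i))) ⟩
  ℚᵘ.½ ℚᵘ.* (i ℚᵘ./ n)        ≈⟨ ℚᵘ.*-cong (ℚᵘ.≃-refl {ℚᵘ.½}) (toℚᵘ-/ i n) ⟨
  toℚᵘ ½ ℚᵘ.* toℚᵘ (i / n)    ≈⟨ ℚ.toℚᵘ-homo-* ½ (i / n) ⟨
  toℚᵘ (½ * (i / n))          ∎)
  where open ℚᵘ.≃-Reasoning

floor-≤ : ∀ q → floor q / 1 ≤ q
floor-≤ q@(mkℚ n d-1 _) = ℚ.toℚᵘ-cancel-≤
  (ℚᵘ.≤-respˡ-≃ (ℚᵘ.≃-sym (toℚᵘ-/ (floor q) 1)) (ℚᵘ.*≤*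
    (subst (floor q ℤ.* + suc d-1 ℤ.≤_) (sym (ℤ.*-identityʳ n))
      (ℤ.[n/d]*d≤n n (+ suc d-1)))))

<-floor+1 : ∀ q → q < floor q / 1 + 1ℚ
<-floor+1 q@(mkℚ n d-1 _) = subst (q <_) (/1-homo-+ (floor q) (+ 1)) (ℚ.toℚᵘ-cancel-<
  (ℚᵘ.<-respʳ-≃ (ℚᵘ.≃-sym (toℚᵘ-/ (floor q ℤ.+ + 1) 1)) (ℚᵘ.*<*
    (subst₂ ℤ._<_ (sym (ℤ.*-identityʳ n))
      (cong (ℤ._* + suc d-1) (trans (cong ℤ.suc (sym (ℤ.div-pos-is-/ℕ n (suc d-1))))
                                    (ℤ.+-comm (+ 1) (floor q))))
      (ℤ.n<s[n/ℕd]*d n (suc d-1))))))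

------------------------------------------------------------------------
-- Inequalities between rationals

p≤q⇒0≤q-p : ∀ {p q} → p ≤ q → 0ℚ ≤ q - p
p≤q⇒0≤q-p {p} {q} p≤q = subst (_≤ q - p) (ℚ.+-inverseʳ p) (ℚ.+-monoˡ-≤ (- p) p≤q)

half+half : ∀ p → ½ * p + ½ * p ≡ p
half+half p = trans (sym (ℚ.*-distribʳ-+ p ½ ½)) (ℚ.*-identityˡ p)

-- The midpoint of [0, 2h] is within h of every point of the interval.
distance-to-midpoint : ∀ {y h} → 0ℚ ≤ y → y ≤ h + h → ∣ y - h ∣ ≤ h
distance-to-midpoint {y} {h} 0≤y y≤2h with ℚ.∣p∣≡p∨∣p∣≡-p (y - h)
... | inj₁ eq = subst₂ _≤_ (sym eq) (x+y-y≡x h h) (ℚ.+-monoˡ-≤ (- h) y≤2h)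
... | inj₂ eq = subst₂ _≤_
      (trans (solve 2 (λ y h → :- y :+ h := :- (y :- h)) refl y h) (sym eq))
      (ℚ.+-identityˡ h) (ℚ.+-monoˡ-≤ h (ℚ.neg-antimono-≤ 0≤y))

------------------------------------------------------------------------
-- Rounding errors

-- The point ⌊2^υ z + ½⌋ / 2^υ of the grid is within 2^(-υ) / 2 of z, hence so is a
-- nearest point of the grid.
rounding-error : ∀ υ {rnd} → IsRounding υ rnd → ∀ z → 0ℚ ≤ z → z ≤ 1ℚ →
                 ∣ rnd z - z ∣ ≤ ½ * pow2 (ℤ.- υ)
rounding-error υ isRounding z 0≤z z≤1 =
  ℚ.≤-trans (proj₂ (isRounding z 0≤z z≤1) w (n , on-grid)) w-near
  where
  open ≡-Reasoning
  D δ u f w : ℚ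
  D = pow2 υ
  δ = pow2 (ℤ.- υ)
  u = D * z + ½
  n : ℤ
  n = floor u
  f = n / 1
  w = f * δ

  instance
    δ-nonNeg : ℚ.NonNegative δ
    δ-nonNeg = ℚ.pos⇒nonNeg δ {{pow2-positive (ℤ.- υ)}}

  on-grid : D * w ≡ f
  on-grid = begin
    D * (f * δ)  ≡⟨ solve 3 (λ D f δ → D :* (f :* δ) := f :* (D :* δ)) refl D f δ ⟩
    f * (D * δ)  ≡⟨ cong (f *_) (pow2-inverse υ) ⟩
    f * 1ℚ       ≡⟨ ℚ.*-identityʳ f ⟩
    f            ∎

  -- 1 - (u - f) lies in [0, 1], and (1 - (u - f)) - ½ = f - D z.
  offset : ℚ
  offset = f + 1ℚ - u

  offset-centred : offset - ½ ≡ f - D * z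
  offset-centred = solve 2 (λ f v → f :+ con 1ℚ :- (v :+ con ½) :- con ½ := f :- v)
    refl f (D * z)

  offset≤1 : offset ≤ ½ + ½
  offset≤1 = subst (offset ≤_)
    (solve 1 (λ u → u :+ con 1ℚ :- u := con 1ℚ) refl u)
    (ℚ.+-monoˡ-≤ (- u) (ℚ.+-monoˡ-≤ 1ℚ (floor-≤ u)))

  near : ∣ f - D * z ∣ ≤ ½
  near = subst (λ v → ∣ v ∣ ≤ ½) offset-centred
    (distance-to-midpoint (p≤q⇒0≤q-p (ℚ.<⇒≤ (<-floor+1 u))) offset≤1)

  w-z : w - z ≡ (f - D * z) * δ
  w-z = begin
    f * δ - z            ≡⟨ cong (λ v → f * δ - v) (ℚ.*-identityʳ z) ⟨
    f * δ - z * 1ℚ       ≡⟨ cong (λ v → f * δ - z * v) (pow2-inverse υ) ⟨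
    f * δ - z * (D * δ)  ≡⟨ solve 4 (λ f δ z D → f :* δ :- z :* (D :* δ) := (f :- D :* z) :* δ)
                              refl f δ z D ⟩
    (f - D * z) * δ      ∎

  w-near : ∣ w - z ∣ ≤ ½ * δ
  w-near = subst (_≤ ½ * δ)
    (sym (trans (cong ∣_∣ w-z) (trans (ℚ.∣p*q∣≡∣p∣*∣q∣ (f - D * z) δ)
      (cong (∣ f - D * z ∣ *_) (ℚ.0≤p⇒∣p∣≡p (ℚ.nonNegative⁻¹ δ))))))
    (ℚ.*-monoʳ-≤-nonNeg δ near)

------------------------------------------------------------------------
-- Windows of a sequence

-- The sum of the first n terms.
prefix : (ℕ → ℚ) → ℕ → ℚ
prefix f zero    = 0ℚ
prefix f (suc n) = prefix f n + f n

-- The sum of the last W of the first t terms, of all of them if t < W: the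
-- truncated subtraction implements the convention that the sequence is 0 before
-- its beginning.
window : (ℕ → ℚ) → ℕ → ℕ → ℚ
window f W t = prefix f t - prefix f (t ∸ W)

-- The term that leaves the window when t becomes t + 1, which is 0 if t < W.
leaving : (ℕ → ℚ) → ℕ → ℕ → ℚ
leaving f W t = prefix f (suc t ∸ W) - prefix f (t ∸ W)

leaving-start : ∀ f {W t} → t ℕ.< W → leaving f W t ≡ 0ℚ
leaving-start f {W} {t} t<W = cong₂ (λ m n → prefix f m - prefix f n)
  (ℕ.m≤n⇒m∸n≡0 t<W) (ℕ.m≤n⇒m∸n≡0 (ℕ.<⇒≤ t<W))

leaving-shift : ∀ f W t → leaving f W (t ℕ.+ W) ≡ f t
leaving-shift f W t = trans
  (cong₂ (λ m n → prefix f m - prefix f n) (ℕ.m+n∸n≡m (suc t) W) (ℕ.m+n∸n≡m t W))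
  (solve 2 (λ p x → p :+ x :- p := x) refl (prefix f t) (f t))

window-suc : ∀ f W t → window f W (suc t) ≡ window f W t - leaving f W t + f t
window-suc f W t = solve 4
  (λ p x q r → p :+ x :- r := p :- q :- (r :- q) :+ x) refl
  (prefix f t) (f t) (prefix f (t ∸ W)) (prefix f (suc t ∸ W))

prefix-linear : ∀ f g c n → prefix (λ m → f m - g m * c) n ≡ prefix f n - prefix g n * c
prefix-linear f g c zero    = solve 1 (λ c → con 0ℚ := con 0ℚ :- con 0ℚ :* c) refl c
prefix-linear f g c (suc n) = trans
  (cong (_+ (f n - g n * c)) (prefix-linear f g c n))
  (solve 5 (λ p q x y c → p :- q :* c :+ (x :- y :* c) := p :+ x :- (q :+ y) :* c) refl
    (prefix f n) (prefix g n) (f n) (g n) c)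

module _ (f : ℕ → ℚ) {η : ℚ} (f-small : ∀ n → ∣ f n ∣ ≤ η) where

  ∣window∣≤ : ∀ W t → ∣ window f W t ∣ ≤ + W / 1 * η
  ∣window∣≤ zero    t = ℚ.≤-reflexive (trans
    (cong ∣_∣ (ℚ.+-inverseʳ (prefix f t))) (sym (ℚ.*-zeroˡ η)))
  ∣window∣≤ (suc W) t = begin
    ∣ window f (suc W) t ∣
      ≡⟨ cong (λ n → ∣ prefix f t - prefix f n ∣) (ℕ.pred[m∸n]≡m∸[1+n] t W) ⟨
    ∣ prefix f t - prefix f (ℕ.pred (t ∸ W)) ∣
      ≡⟨ cong ∣_∣ (solve 3 (λ p q r → p :- r := p :- q :+ (q :- r)) refl
           (prefix f t) (prefix f (t ∸ W)) (prefix f (ℕ.pred (t ∸ W)))) ⟩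
    ∣ window f W t + (prefix f (t ∸ W) - prefix f (ℕ.pred (t ∸ W))) ∣
      ≤⟨ ℚ.∣p+q∣≤∣p∣+∣q∣ (window f W t) _ ⟩
    ∣ window f W t ∣ + ∣ prefix f (t ∸ W) - prefix f (ℕ.pred (t ∸ W)) ∣
      ≤⟨ ℚ.+-mono-≤ (∣window∣≤ W t) (step (t ∸ W)) ⟩
    + W / 1 * η + η
      ≡⟨ solve 2 (λ w η → w :* η :+ η := (con 1ℚ :+ w) :* η) refl (+ W / 1) η ⟩
    (1ℚ + + W / 1) * η
      ≡⟨ cong (_* η) (/1-homo-+ (+ 1) (+ W)) ⟨
    + suc W / 1 * η ∎
    where
    open ℚ.≤-Reasoning
    step : ∀ n → ∣ prefix f n - prefix f (ℕ.pred n) ∣ ≤ η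
    step zero    = ℚ.≤-trans (ℚ.0≤∣p∣ (f 0)) (f-small 0)
    step (suc n) = subst (λ v → ∣ v ∣ ≤ η)
      (solve 2 (λ p x → x := p :+ x :- p) refl (prefix f n) (f n)) (f-small n)

windowSum-start : ∀ {R} W (x : Stream R) → windowSum W x 0 ≡ 0
windowSum-start zero    x = refl
windowSum-start (suc W) x = windowSum-start W x

windowSum≡window : ∀ {R} W (x : Stream R) t →
                   + windowSum W x t / 1 ≡ window (λ n → + toℕ (x n) / 1) W t
windowSum≡window zero x t = sym (ℚ.+-inverseʳ (prefix (λ n → + toℕ (x n) / 1) t))
windowSum≡window (suc W) x zero = cong (λ n → + n / 1) (windowSum-start (suc W) x)
windowSum≡window (suc W) x (suc t) = begin
  + (toℕ (x t) ℕ.+ windowSum W x t) / 1     ≡⟨ /1-homo-+ (+ toℕ (x t)) (+ windowSum W x t) ⟩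
  X t + + windowSum W x t / 1               ≡⟨ cong (λ v → X t + v) (windowSum≡window W x t) ⟩
  X t + (prefix X t - prefix X (t ∸ W))     ≡⟨ solve 3 (λ a p q → a :+ (p :- q) := p :+ a :- q)
                                                 refl (X t) (prefix X t) (prefix X (t ∸ W)) ⟩
  prefix X t + X t - prefix X (t ∸ W)       ∎
  where
  open ≡-Reasoning
  X : ℕ → ℚ
  X n = + toℕ (x n) / 1

------------------------------------------------------------------------
-- Residues

suc-mod : ∀ W .{{_ : NonZero W}} t → suc (toℕ (t mod W)) mod W ≡ suc t mod W
suc-mod W t = Fin.toℕ-injective (begin
  toℕ (suc (toℕ (t mod W)) mod W)   ≡⟨ Fin.toℕ-fromℕ< _ ⟩
  suc (toℕ (t mod W)) % W           ≡⟨ cong (λ r → suc r % W) (Fin.toℕ-fromℕ< _) ⟩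
  (1 ℕ.+ t % W) % W                 ≡⟨ ℕ.%-distribˡ-+ 1 (t % W) W ⟩
  (1 % W ℕ.+ t % W % W) % W         ≡⟨ cong (λ r → (1 % W ℕ.+ r) % W) (ℕ.m%n%n≡m%n t W) ⟩
  (1 % W ℕ.+ t % W) % W             ≡⟨ ℕ.%-distribˡ-+ 1 t W ⟨
  suc t % W                         ≡⟨ Fin.toℕ-fromℕ< _ ⟨
  toℕ (suc t mod W)                 ∎)
  where open ≡-Reasoning

mod-shift : ∀ W .{{_ : NonZero W}} t → (t ℕ.+ W) mod W ≡ t mod W
mod-shift W t = Fin.toℕ-injective
  (trans (Fin.toℕ-fromℕ< _) (trans (ℕ.[m+n]%n≡m%n t W) (sym (Fin.toℕ-fromℕ< _))))

mod⇒% : ∀ W .{{_ : NonZero W}} {m n} → m mod W ≡ n mod W → m % W ≡ n % W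
mod⇒% W eq = trans (sym (Fin.toℕ-fromℕ< _)) (trans (cong toℕ eq) (Fin.toℕ-fromℕ< _))

-- Unequal numbers less than W apart have different residues: with equal residues,
-- equal quotients would make them equal and unequal ones would separate them by W.
mod-distinct : ∀ W .{{_ : NonZero W}} {t n} → t ℕ.< n → n ℕ.< t ℕ.+ W → n mod W ≢ t mod W
mod-distinct W {t} {n} t<n n<t+W eq with ℕ.<-cmp (t ℕ./ W) (n ℕ./ W)
... | tri≈ _ q≡q′ _ = ℕ.<-irrefl (begin
        t                          ≡⟨ ℕ.m≡m%n+[m/n]*n t W ⟩
        t % W ℕ.+ t ℕ./ W ℕ.* W    ≡⟨ cong₂ (λ r q → r ℕ.+ q ℕ.* W) (mod⇒% W (sym eq)) q≡q′ ⟩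
        n % W ℕ.+ n ℕ./ W ℕ.* W    ≡⟨ ℕ.m≡m%n+[m/n]*n n W ⟨
        n                          ∎) t<n
  where
  open ≡-Reasoning
... | tri> _ _ q>q′ = ℕ.<⇒≱ q>q′ (ℕ./-monoˡ-≤ W (ℕ.<⇒≤ t<n))
... | tri< q<q′ _ _ = ℕ.<⇒≱ n<t+W (begin
        t ℕ.+ W                            ≡⟨ cong (ℕ._+ W) (ℕ.m≡m%n+[m/n]*n t W) ⟩
        t % W ℕ.+ t ℕ./ W ℕ.* W ℕ.+ W      ≡⟨ ℕ.+-assoc (t % W) _ W ⟩
        t % W ℕ.+ (t ℕ./ W ℕ.* W ℕ.+ W)    ≡⟨ cong (t % W ℕ.+_) (ℕ.+-comm _ W) ⟩
        t % W ℕ.+ suc (t ℕ./ W) ℕ.* W      ≤⟨ ℕ.+-mono-≤ (ℕ.≤-reflexive (mod⇒% W (sym eq))) (ℕ.*-monoˡ-≤ W q<q′) ⟩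
        n % W ℕ.+ n ℕ./ W ℕ.* W            ≡⟨ ℕ.m≡m%n+[m/n]*n n W ⟨
        n                                  ∎)
  where
  open ℕ.≤-Reasoning

------------------------------------------------------------------------
-- Runs of the algorithm

module Analysis (W R k : ℕ) .{{_ : NonZero W}} .{{_ : NonZero R}} .{{_ : NonZero k}}
                (rnd : ℚ → ℚ) (x : Stream R) where

  open Algorithm W R k rnd

  state : ℕ → State W
  state = run x

  private
    instance
      block-pos : Positive block
      block-pos = /-positive W k

  -- The scaled element that step t rounds, and its rounding.
  scaled rounded : ℕ → ℚ
  scaled t  = + toℕ (x t) / R
  rounded t = rnd (scaled t)

  -- The number y + x′ that step t splits into blocks, and the value that it writes to
  -- the array: the number of whole blocks, as a rational.
  pool blocks : ℕ → ℚ
  pool t   = State.y (state t) + rounded t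
  blocks t = floor (divide block (pool t)) / 1

  index : ∀ t → State.i (state t) ≡ t mod W
  index zero    = refl
  index (suc t) = trans (cong (λ i → suc (toℕ i) mod W) (index t)) (suc-mod W t)

  -- At time t the array holds, for each n with t ≤ n < t + W, the value that step n
  -- is going to overwrite.  That value leaves the window of the last W values written.
  slots : ∀ t {n} → t ℕ.≤ n → n ℕ.< t ℕ.+ W →
          lookup (State.b (state t)) (n mod W) / 1 ≡ leaving blocks W n
  slots zero {n} _ n<W = trans (cong (_/ 1) (Vec.lookup-replicate (n mod W) (+ 0)))
                               (sym (leaving-start blocks n<W))
  slots (suc t) {n} t<n n<1+t+W with n ℕ.≟ t ℕ.+ W
  -- Step t has just written this slot, and step t + W is the next to use it.
  ... | yes refl = trans
    (cong (_/ 1) (trans (cong (lookup (State.b (state (suc t))))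
                              (trans (mod-shift W t) (sym (index t))))
                        (Vec.lookup∘update (State.i (state t)) (State.b (state t)) _)))
    (sym (leaving-shift blocks W t))
  ... | no n≢t+W = trans
    (cong (_/ 1) (Vec.lookup∘update′
      (λ eq → mod-distinct W t<n n<t+W (trans eq (index t))) (State.b (state t)) _))
    (slots t (ℕ.<⇒≤ t<n) n<t+W)
    where
    n<t+W : n ℕ.< t ℕ.+ W
    n<t+W = ℕ.≤∧≢⇒< (ℕ.≤-pred n<1+t+W) n≢t+W

  B≡window : ∀ t → State.B (state t) / 1 ≡ window blocks W t
  B≡window zero    = sym (cong (λ n → 0ℚ - prefix blocks n) (ℕ.0∸n≡0 W))
  B≡window (suc t) = begin
    (B ℤ.- old ℤ.+ new) / 1               ≡⟨ /1-homo-+ (B ℤ.- old) new ⟩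
    (B ℤ.- old) / 1 + blocks t            ≡⟨ cong (_+ blocks t) (/1-homo-- B old) ⟩
    B / 1 - old / 1 + blocks t            ≡⟨ cong₂ (λ p q → p - q + blocks t) (B≡window t) old≡ ⟩
    window blocks W t - leaving blocks W t + blocks t
                                          ≡⟨ window-suc blocks W t ⟨
    window blocks W (suc t)               ∎
    where
    open ≡-Reasoning
    B old new : ℤ
    B   = State.B (state t)
    old = lookup (State.b (state t)) (State.i (state t))
    new = floor (divide block (pool t))
    old≡ : old / 1 ≡ leaving blocks W t
    old≡ = trans (cong (λ i → lookup (State.b (state t)) i / 1) (index t))
                 (slots t ℕ.≤-refl (ℕ.m<m+n t (ℕ.>-nonZero⁻¹ W)))

  -- No mass is lost: what is not in the blocks is in the remainder y.
  y≡ : ∀ t → State.y (state t) ≡ prefix rounded t - prefix blocks t * block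
  y≡ zero    = solve 1 (λ c → con 0ℚ := con 0ℚ :- con 0ℚ :* c) refl block
  y≡ (suc t) = trans (cong (λ y → y + rounded t - blocks t * block) (y≡ t))
    (solve 5 (λ p q a b c → p :- q :* c :+ a :- b :* c := p :+ a :- (q :+ b) :* c) refl
      (prefix rounded t) (prefix blocks t) (rounded t) (blocks t) block)

  0≤y : ∀ t → 0ℚ ≤ State.y (state t)
  0≤y zero    = ℚ.≤-refl
  0≤y (suc t) = p≤q⇒0≤q-p (subst (blocks t * block ≤_) (divide-* block (pool t))
    (ℚ.*-monoʳ-≤-nonNeg block {{ℚ.pos⇒nonNeg block}} (floor-≤ (divide block (pool t)))))

  y≤block : ∀ t → State.y (state t) ≤ block
  y≤block zero    = ℚ.<⇒≤ (ℚ.positive⁻¹ block)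
  y≤block (suc t) = subst (pool t - blocks t * block ≤_)
    (solve 2 (λ b c → (b :+ con 1ℚ) :* c :- b :* c := c) refl (blocks t) block)
    (ℚ.+-monoˡ-≤ (- (blocks t * block))
      (subst (_≤ (blocks t + 1ℚ) * block) (divide-* block (pool t))
        (ℚ.*-monoʳ-≤-nonNeg block {{ℚ.pos⇒nonNeg block}}
          (ℚ.<⇒≤ (<-floor+1 (divide block (pool t)))))))

  ----------------------------------------------------------------------
  -- The error of the estimate

  -- The rounding error of step t.  The scaled element is written as a product with
  -- 1 / R, so that the sums of the errors are linear in those of the elements.
  element error : ℕ → ℚ
  element t = + toℕ (x t) / 1
  error t   = rounded t - element t * (+ 1 / R)

  -- The error of the estimate has two sources: the distance from the remainder of
  -- W steps ago to the middle of the interval [0, W / k] it ranges over, and the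
  -- rounding errors in the window.
  estimate-error : ∀ t → estimate x t - + windowSum W x t / 1 ≡
    + R / 1 * ((State.y (state (t ∸ W)) - ½ * block) + window error W t)
  estimate-error t = begin
    r * (block * (State.B (state t) / 1) + State.y (state t) - (+ W / (2 ℕ.* k)) {{ℕ.m*n≢0 2 k}})
      - + windowSum W x t / 1
      ≡⟨ cong₂ _-_ (cong (r *_) (cong₂ _-_
           (cong₂ (λ p q → block * p + q) (B≡window t) (y≡ t)) (/-half (+ W) k)))
           (windowSum≡window W x t) ⟩
    r * (block * (P t - P s) + (Ξ t - P t * block) - ½ * block) - (X t - X s)
      ≡⟨ cong (λ v → r * (block * (P t - P s) + (Ξ t - P t * block) - ½ * block) - v)
           (trans (sym (ℚ.*-identityʳ (X t - X s)))
                  (cong ((X t - X s) *_) (sym (n*1/n≡1 R)))) ⟩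
    r * (block * (P t - P s) + (Ξ t - P t * block) - ½ * block) - (X t - X s) * (r * c)
      ≡⟨ solve 10 (λ r c b h Pt Ps Ξt Ξs Xt Xs →
           r :* (b :* (Pt :- Ps) :+ (Ξt :- Pt :* b) :- h) :- (Xt :- Xs) :* (r :* c) :=
           r :* (((Ξs :- Ps :* b) :- h) :+ ((Ξt :- Xt :* c) :- (Ξs :- Xs :* c))))
           refl r c block (½ * block) (P t) (P s) (Ξ t) (Ξ s) (X t) (X s) ⟩
    r * (((Ξ s - P s * block) - ½ * block) + ((Ξ t - X t * c) - (Ξ s - X s * c)))
      ≡⟨ cong₂ (λ p q → r * ((p - ½ * block) + q)) (y≡ s)
           (cong₂ _-_ (prefix-linear rounded element c t) (prefix-linear rounded element c s)) ⟨
    r * ((State.y (state s) - ½ * block) + window error W t) ∎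
    where
    open ≡-Reasoning
    s : ℕ
    s = t ∸ W
    r c : ℚ
    r = + R / 1
    c = + 1 / R
    P Ξ X : ℕ → ℚ
    P = prefix blocks
    Ξ = prefix rounded
    X = prefix element

  module _ (υ : ℤ) (isRounding : IsRounding υ rnd) where

    error-small : ∀ t → ∣ error t ∣ ≤ ½ * pow2 (ℤ.- υ)
    error-small t = subst (λ z → ∣ rounded t - z ∣ ≤ ½ * pow2 (ℤ.- υ)) (scaled≡ t)
      (rounding-error υ isRounding (scaled t) 0≤scaled scaled≤1)
      where
      scaled≡ : ∀ t → scaled t ≡ element t * (+ 1 / R)
      scaled≡ t = /-as-product (+ toℕ (x t)) R
      instance
        1/R-nonNeg : ℚ.NonNegative (+ 1 / R)
        1/R-nonNeg = ℚ.normalize-nonNeg 1 R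
      0≤scaled : 0ℚ ≤ scaled t
      0≤scaled = ℚ.nonNegative⁻¹ (scaled t) {{ℚ.normalize-nonNeg (toℕ (x t)) R}}
      R-x : ℚ
      R-x = + (R ∸ toℕ (x t)) / 1
      element≤R : element t ≤ + R / 1
      element≤R = subst₂ _≤_ (ℚ.+-identityʳ (element t))
        (trans (sym (/1-homo-+ (+ toℕ (x t)) (+ (R ∸ toℕ (x t)))))
          (cong (λ n → + n / 1) (ℕ.m+[n∸m]≡n (ℕ.≤-pred (Fin.toℕ<n (x t))))))
        (ℚ.+-monoʳ-≤ (element t)
          (ℚ.nonNegative⁻¹ R-x {{ℚ.normalize-nonNeg (R ∸ toℕ (x t)) 1}}))
      scaled≤1 : scaled t ≤ 1ℚ
      scaled≤1 = subst₂ _≤_ (sym (scaled≡ t)) (n*1/n≡1 R)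
        (ℚ.*-monoʳ-≤-nonNeg (+ 1 / R) element≤R)

    ∣estimate-error∣≤ : ∀ t → ∣ estimate x t - + windowSum W x t / 1 ∣ ≤
      + R / 1 * (+ W / 1 * (½ * (+ 1 / k + pow2 (ℤ.- υ))))
    ∣estimate-error∣≤ t = begin
      ∣ estimate x t - + windowSum W x t / 1 ∣
        ≡⟨ trans (cong ∣_∣ (estimate-error t)) (ℚ.∣p*q∣≡∣p∣*∣q∣ (+ R / 1) (α + β)) ⟩
      ∣ + R / 1 ∣ * ∣ α + β ∣
        ≡⟨ cong (_* ∣ α + β ∣) (ℚ.0≤p⇒∣p∣≡p (ℚ.nonNegative⁻¹ (+ R / 1))) ⟩
      + R / 1 * ∣ α + β ∣
        ≤⟨ ℚ.*-monoˡ-≤-nonNeg (+ R / 1) (ℚ.≤-trans (ℚ.∣p+q∣≤∣p∣+∣q∣ α β)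
             (ℚ.+-mono-≤
               (distance-to-midpoint (0≤y (t ∸ W))
                 (subst (State.y (state (t ∸ W)) ≤_) (sym (half+half block)) (y≤block (t ∸ W))))
               (∣window∣≤ error error-small W t))) ⟩
      + R / 1 * (½ * block + + W / 1 * (½ * δ))
        ≡⟨ cong (λ v → + R / 1 * (½ * v + + W / 1 * (½ * δ))) (/-as-product (+ W) k) ⟩
      + R / 1 * (½ * (+ W / 1 * (+ 1 / k)) + + W / 1 * (½ * δ))
        ≡⟨ solve 5 (λ r w h j δ → r :* (h :* (w :* j) :+ w :* (h :* δ)) :=
                                    r :* (w :* (h :* (j :+ δ))))
             refl (+ R / 1) (+ W / 1) ½ (+ 1 / k) δ ⟩
      + R / 1 * (+ W / 1 * (½ * (+ 1 / k + δ))) ∎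
      where
      open ℚ.≤-Reasoning
      δ α β : ℚ
      δ = pow2 (ℤ.- υ)
      α = State.y (state (t ∸ W)) - ½ * block
      β = window error W t
      instance
        R-nonNeg : ℚ.NonNegative (+ R / 1)
        R-nonNeg = ℚ.normalize-nonNeg R 1

------------------------------------------------------------------------
-- The accuracy in terms of ε

-- If p < q < 1 / k, then q cannot be an upper bound of g, as k q < 1 would make k a
-- strict lower bound of 1 / g; so by locatedness p is below g.
1/k≤gap : ∀ (g : ℝ) (g>0 : fromℚ 0ℚ <ℝ g) k .{{_ : NonZero k}} →
          inv g g>0 ≤ℝ fromℚ (+ k / 1) → fromℚ (+ 1 / k) ≤ℝ g
1/k≤gap g g>0 k 1/g≤k p p<1/k with ℚ.<-dense p<1/k
... | q , p<q , q<1/k with located g p<q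
...   | inj₁ lp = lp
...   | inj₂ uq = ⊥-elim (ℚ.<-irrefl refl (1/g≤k (+ k / 1) (q , uq , kq<1)))
  where
  kq<1 : + k / 1 * q < 1ℚ
  kq<1 = subst (+ k / 1 * q <_) (n*1/n≡1 k)
    (ℚ.*-monoʳ-<-pos (+ k / 1) {{/-positive k 1}} q<1/k)

-- The hypothesis reads c ≤ 2 ε - 2^(-υ).  It is used with c = 1 / k.
half-sum≤ε : ∀ ε υ c → fromℚ c ≤ℝ gap ε υ → fromℚ (½ * (c + pow2 (ℤ.- υ))) ≤ℝ ε
half-sum≤ε ε υ c c≤gap q q<avg = subst (L ε) (begin
    (q + q - δ + δ) * (+ 1 / 2)  ≡⟨ cong (_* ½) (x-y+y≡x (q + q) δ) ⟩
    (q + q) * ½                  ≡⟨ solve 2 (λ q h → (q :+ q) :* h := h :* q :+ h :* q) refl q ½ ⟩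
    ½ * q + ½ * q                ≡⟨ half+half q ⟩
    q                            ∎)
  (c≤gap (q + q - δ) (subst (q + q - δ <_) (begin
    ½ * (c + δ) + ½ * (c + δ) - δ  ≡⟨ cong (_- δ) (half+half (c + δ)) ⟩
    c + δ - δ                      ≡⟨ x+y-y≡x c δ ⟩
    c                              ∎)
    (ℚ.+-monoˡ-< (- δ) (ℚ.+-mono-< q<avg q<avg))))
  where
  open ≡-Reasoning
  δ : ℚ
  δ = pow2 (ℤ.- υ)

fromℚ-≤-· : ∀ n .{{_ : NonZero n}} a x → fromℚ a ≤ℝ x → fromℚ (+ n / 1 * a) ≤ℝ n · x
fromℚ-≤-· n a x a≤x q q<na = a≤x (q * (+ 1 / n))
  (subst (q * (+ 1 / n) <_) na/n≡a (ℚ.*-monoˡ-<-pos (+ 1 / n) {{/-positive 1 n}} q<na))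
  where
  open ≡-Reasoning
  na/n≡a : + n / 1 * a * (+ 1 / n) ≡ a
  na/n≡a = begin
    + n / 1 * a * (+ 1 / n)    ≡⟨ solve 3 (λ n a c → n :* a :* c := a :* (n :* c)) refl
                                    (+ n / 1) a (+ 1 / n) ⟩
    a * (+ n / 1 * (+ 1 / n))  ≡⟨ cong (a *_) (n*1/n≡1 n) ⟩
    a * 1ℚ                     ≡⟨ ℚ.*-identityʳ a ⟩
    a                          ∎

theorem17 : (W R : ℕ) .{{_ : NonZero W}} .{{_ : NonZero R}}
    (ε : ℝ) (ε>0 : fromℚ 0ℚ <ℝ ε)
    (υ : ℤ) (υ-def : IsCeilingLog₂ (W · inv ε ε>0) υ) →
    let gap>0 = gap-positive W ε ε>0 υ υ-def
        1/gap = inv (gap ε υ) gap>0 in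
    (k : ℕ) (k-def : IsCeiling 1/gap (+ k)) →
    let instance k≢0 = ceiling-nonZero 1/gap k (inv-positive (gap ε υ) gap>0) k-def in
    (rnd : ℚ → ℚ) → IsRounding υ rnd →
    (x : Stream R) (t : ℕ) →
    fromℚ ∣ Algorithm.estimate W R k rnd x t - + windowSum W x t / 1 ∣ ≤ℝ R · W · ε
theorem17 W R ε ε>0 υ υ-def k k-def rnd isRounding x t q q<error =
  fromℚ-≤-· R (+ W / 1 * a) (W · ε)
    (fromℚ-≤-· W a ε
      (half-sum≤ε ε υ (+ 1 / k) (1/k≤gap (gap ε υ) gap>0 k (proj₂ k-def))))
    q (ℚ.<-≤-trans q<error (Analysis.∣estimate-error∣≤ W R k rnd x υ isRounding t))
  where
  gap>0 : fromℚ 0ℚ <ℝ gap ε υ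
  gap>0 = gap-positive W ε ε>0 υ υ-def
  instance
    k≢0 : NonZero k
    k≢0 = ceiling-nonZero (inv (gap ε υ) gap>0) k (inv-positive (gap ε υ) gap>0) k-def
  a : ℚ
  a = ½ * (+ 1 / k + pow2 (ℤ.- υ))
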